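{- For $n>0$ and $J\subseteq S$, there is a bijection $\mathfrak{S}_n^J(231)\simeq\mathrm{NC}_n^J$.
   Context: $\mathfrak{S}_n$ is the symmetric group on $[n]=\{1,\dots,n\}$, $s_i=(i,i+1)$, $S=\{s_1,\dots,s_{n-1}\}$, one-line notation $w=w_1\cdots w_n$. For $J\subseteq S$, $\mathfrak{S}_n^J$ is the set of $w$ with $w_i<w_{i+1}$ whenever $s_i\in J$. Writing $J=S\setminus\{s_{j_1},\dots,s_{j_r}\}$ with $j_1<\dots<j_r$, the $J$-regions are $\{1,\dots,j_1\},\{j_1+1,\dots,j_2\},\dots,\{j_r+1,\dots,n\}$. $\mathfrak{S}_n^J(231)$ is the set of $w\in\mathfrak{S}_n^J$ admitting no indices $i<j<k$ in pairwise different $J$-regions with $w_k<w_i<w_j$ and $w_i=w_k+1$. For a set partition $\mathbf P$ of $[n]$, a bump is a pair $(a,b)$, $a<b$, with $a,b$ in the same part and no element of that part strictly between them. $\mathbf P$ is $J$-noncrossing if: (NC1) no two distinct elements of the same $J$-region lie in the same part; (NC2) whenever two distinct bumps $(i_1,i_2),(j_1,j_2)$ satisfy $i_1<j_1<i_2<j_2$, either $i_1,j_1$ lie in the same $J$-region or $i_2,j_1$ lie in the same $J$-region; (NC3) whenever two distinct bumps satisfy $i_1<j_1<j_2<i_2$, then $i_1$ and $j_1$ lie in different $J$-regions. $\mathrm{NC}_n^J$ denotes the set of $J$-noncrossing partitions of $[n]$. -}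

module Defs where

open import Data.Nat using (ℕ; suc; _≤_; _<_)
open import Data.Fin as Fin using (Fin; inject₁; toℕ)
open import Data.Fin.Permutation as Perm using (Permutation′; _⟨$⟩ʳ_)
open import Data.Fin.Subset using (Subset; _∈_; _∉_; _∩_; Nonempty; Empty)
open import Data.List using (List)
import Data.List.Membership.Propositional as List
open import Data.List.Relation.Binary.BagAndSetEquality using (set; [_]-Equality)
open import Data.Product using (Σ; ∃-syntax; _×_)
open import Data.Sum using (_⊎_)
open import Level using (0ℓ)
open import Relation.Binary.Bundles using (Setoid)
open import Relation.Binary.PropositionalEquality using (_≡_; _≢_; refl; sym; trans)
open import Relation.Nullary using (¬_)
import Relation.Binary.Construct.On as On

-- Throughout n = suc m, the set [n] is Fin (suc m) (so toℕ a = a - 1), and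
-- J ⊆ S is a Subset m: the index i : Fin m stands for the simple
-- transposition of the adjacent positions inject₁ i and Fin.suc i,
-- that is, for s_j with j = suc (toℕ i).

-- The boundaries 0 = j₀ < j₁ < ⋯ < j_r < j_{r+1} = n, where s_{j₁}, …, s_{j_r}
-- are the simple transpositions missing from J.
data Cut {m : ℕ} (J : Subset m) : ℕ → Set where
  start   : Cut J 0
  missing : (i : Fin m) → i ∉ J → Cut J (suc (toℕ i))
  end     : Cut J (suc m)

-- The region {lo + 1, …, hi}, for consecutive boundaries lo < hi.
record Region {m : ℕ} (J : Subset m) : Set where
  field
    lo hi       : ℕ
    lo-cut      : Cut J lo
    hi-cut      : Cut J hi
    lo<hi       : lo < hi
    consecutive : ∀ k → lo < k → k < hi → ¬ Cut J k

_∈ᴿ_ : {m : ℕ} {J : Subset m} → Fin (suc m) → Region J → Set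
a ∈ᴿ R = Region.lo R ≤ toℕ a × toℕ a < Region.hi R

SameRegion : {m : ℕ} → Subset m → Fin (suc m) → Fin (suc m) → Set
SameRegion J a b = Σ (Region J) λ R → a ∈ᴿ R × b ∈ᴿ R

-- Membership in 𝔖ₙᴶ; the one-line notation of w is w_i = w ⟨$⟩ʳ i.
InQuotient : {m : ℕ} → Subset m → Permutation′ (suc m) → Set
InQuotient {m} J w =
  (i : Fin m) → i ∈ J → (w ⟨$⟩ʳ inject₁ i) Fin.< (w ⟨$⟩ʳ Fin.suc i)

record Is231Pattern {m : ℕ} (J : Subset m) (w : Permutation′ (suc m))
                    (i j k : Fin (suc m)) : Set where
  field
    i<j      : i Fin.< j
    j<k      : j Fin.< k
    ij-apart : ¬ SameRegion J i j
    jk-apart : ¬ SameRegion J j k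
    ik-apart : ¬ SameRegion J i k
    wk<wi    : (w ⟨$⟩ʳ k) Fin.< (w ⟨$⟩ʳ i)
    wi<wj    : (w ⟨$⟩ʳ i) Fin.< (w ⟨$⟩ʳ j)
    wi≡wk+1  : toℕ (w ⟨$⟩ʳ i) ≡ suc (toℕ (w ⟨$⟩ʳ k))

record Avoiding231 {m : ℕ} (J : Subset m) : Set where
  field
    perm       : Permutation′ (suc m)
    inQuotient : InQuotient J perm
    avoids     : ∀ i j k → ¬ Is231Pattern J perm i j k

-- 𝔖ₙᴶ(231) as a subset of 𝔖ₙ: permutations are compared pointwise and the
-- membership proofs are ignored.
𝔖231 : {m : ℕ} → Subset m → Setoid 0ℓ 0ℓ
𝔖231 J = record
  { Carrier       = Avoiding231 J
  ; _≈_           = λ u v → Avoiding231.perm u Perm.≈ Avoiding231.perm v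
  ; isEquivalence = record
    { refl  = λ _ → refl
    ; sym   = λ p i → sym (p i)
    ; trans = λ p q i → trans (p i) (q i)
    }
  }

-- The set of parts is a list considered up to order and repetition.
record SetPartition (n : ℕ) : Set where
  field
    parts    : List (Subset n)
    nonempty : ∀ {p} → p List.∈ parts → Nonempty p
    disjoint : ∀ {p q} → p List.∈ parts → q List.∈ parts → p ≢ q → Empty (p ∩ q)
    covers   : ∀ a → ∃[ p ] (p List.∈ parts × a ∈ p)

open SetPartition public using (parts)

SamePart : {n : ℕ} → SetPartition n → Fin n → Fin n → Set
SamePart P a b = ∃[ p ] (p List.∈ parts P × a ∈ p × b ∈ p)

Bump : {n : ℕ} → SetPartition n → Fin n → Fin n → Set
Bump P a b = a Fin.< b × SamePart P a b
           × (∀ c → a Fin.< c → c Fin.< b → ¬ SamePart P a c)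

-- In nc2 and nc3 the two bumps are automatically distinct, since i₁ < j₁.
record IsNoncrossing {m : ℕ} (J : Subset m) (P : SetPartition (suc m)) : Set where
  field
    nc1 : ∀ {a b} → a ≢ b → SameRegion J a b → ¬ SamePart P a b
    nc2 : ∀ {i₁ i₂ j₁ j₂} → Bump P i₁ i₂ → Bump P j₁ j₂ →
          i₁ Fin.< j₁ → j₁ Fin.< i₂ → i₂ Fin.< j₂ →
          SameRegion J i₁ j₁ ⊎ SameRegion J i₂ j₁
    nc3 : ∀ {i₁ i₂ j₁ j₂} → Bump P i₁ i₂ → Bump P j₁ j₂ →
          i₁ Fin.< j₁ → j₁ Fin.< j₂ → j₂ Fin.< i₂ →
          ¬ SameRegion J i₁ j₁

record NoncrossingPartition {m : ℕ} (J : Subset m) : Set where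
  field
    partition     : SetPartition (suc m)
    isNoncrossing : IsNoncrossing J partition

-- NCₙᴶ: two partitions are equal when they have the same set of parts.
NC : {m : ℕ} → Subset m → Setoid 0ℓ 0ℓ
NC {m} J = On.setoid ([ set ]-Equality (Subset (suc m)))
  λ (P : NoncrossingPartition J) → parts (NoncrossingPartition.partition P)

{-# OPTIONS --safe #-}
module Submission where

open import Data.Nat as ℕ using (ℕ; zero; suc; _+_; _≤_; _<_; z≤n; s≤s)
import Data.Nat.Properties as ℕ
open import Data.Nat.Induction using (<-wellFounded)
import Data.Bool.Properties as Bool
open import Data.Fin as Fin using (Fin; toℕ; fromℕ<; inject₁; punchOut)
import Data.Fin.Properties as Fin
open import Data.Fin.Permutation as Perm using (Permutation′; _⟨$⟩ʳ_; _⟨$⟩ˡ_)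
open import Data.Fin.Subset using (Subset; _∈_; _∉_; _⊆_; ∣_∣; ⊤; _∩_; Empty)
open import Data.Fin.Subset.Properties using (_∈?_; ⊆-antisym; ∈⊤; ⊆⊤; ∣⊤∣≡n; p⊂q⇒∣p∣<∣q∣; x∈p∩q⁺; x∈p∩q⁻)
open import Data.List using (map; allFin)
import Data.List.Membership.Propositional as List
open import Data.List.Membership.Propositional.Properties using (∈-map⁺; ∈-map⁻; ∈-allFin)
open import Data.Product using (∃-syntax; _×_; _,_; proj₁; proj₂)
open import Data.Sum using (_⊎_; inj₁; inj₂; [_,_]′)
open import Data.Vec using (tabulate)
open import Data.Vec.Properties using (≡-dec; lookup∘tabulate; []=⇒lookup; lookup⇒[]=)
open import Function using (_∘_)
open import Function.Bundles using (Bijection; Equivalence; _⇔_; mk⇔)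
open import Function.Definitions using (Injective)
open import Induction.WellFounded using (Acc; acc)
open import Relation.Binary.Bundles using (Setoid)
open import Relation.Binary.Definitions using (tri<; tri≈; tri>; Tri)
open import Relation.Binary.PropositionalEquality using (_≡_; _≢_; refl; sym; trans; cong; subst)
open import Relation.Nullary using (¬_; Dec; yes; no; does; contradiction)
open import Relation.Nullary.Decidable using (map′; _×-dec_; _⊎-dec_; _→-dec_; ¬?; decidable-stable; dec-true)
open import Defs

-- Send w to the partition into the maximal decreasing runs of w⁻¹; its bumps are
-- the pairs i < k with w_i = w_k + 1.  Conversely, the bumps determine the
-- inversions of w: for a < b we have w_b < w_a exactly when a is reached from b
-- by repeatedly passing from a position to the left end i of a bump (i , k) above
-- it (in another region), and finally moving right inside the region reached.
-- For the bumps of any partition, reachability is transitive and splits at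
-- intermediate positions, so it is the inversion relation of a linear order,
-- whose ranking is the inverse image of the partition.  The noncrossing conditions
-- are only needed to see that the bumps are adjacent in that order.

-- Regions

module LastCut {C : ℕ → Set} (C? : ∀ k → Dec (C k)) where

  -- `last k` labels the block of `k` when a new block begins at each element of `C`; the first
  -- block has label `zero` whether or not `C 0` holds. The blocks will be the regions, and later
  -- the runs of w⁻¹.
  last : ℕ → ℕ
  last zero = zero
  last (suc k) with C? (suc k)
  ... | yes _ = suc k
  ... | no _  = last k

  last≤ : ∀ k → last k ≤ k
  last≤ zero = z≤n
  last≤ (suc k) with C? (suc k)
  ... | yes _ = ℕ.≤-refl
  ... | no _  = ℕ.m≤n⇒m≤1+n (last≤ k)

  last-cut : C 0 → ∀ k → C (last k)
  last-cut c zero = c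
  last-cut c (suc k) with C? (suc k)
  ... | yes c′ = c′
  ... | no _   = last-cut c k

  last-max : ∀ {j} k → C j → j ≤ k → j ≤ last k
  last-max zero    c z≤n = z≤n
  last-max (suc k) c j≤1+k with C? (suc k)
  ... | yes _ = j≤1+k
  ... | no ¬c with ℕ.m≤n⇒m<n∨m≡n j≤1+k
  ...   | inj₁ (s≤s j≤k) = last-max k c j≤k
  ...   | inj₂ refl      = contradiction c ¬c

  last-skip : ∀ k → ¬ C (suc k) → last (suc k) ≡ last k
  last-skip k ¬c with C? (suc k)
  ... | yes c = contradiction c ¬c
  ... | no _  = refl

  last-≤suc : ∀ k → last k ≤ last (suc k)
  last-≤suc k with C? (suc k)
  ... | yes _ = ℕ.m≤n⇒m≤1+n (last≤ k)
  ... | no _  = ℕ.≤-refl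

  last-mono : ∀ {j k} → j ≤ k → last j ≤ last k
  last-mono {k = zero}  z≤n = z≤n
  last-mono {k = suc k} j≤1+k with ℕ.m≤n⇒m<n∨m≡n j≤1+k
  ... | inj₁ (s≤s j≤k) = ℕ.≤-trans (last-mono j≤k) (last-≤suc k)
  ... | inj₂ refl      = ℕ.≤-refl

  last-≡⇒¬cut : ∀ {j k l} → last j ≡ last k → j < l → l ≤ k → ¬ C l
  last-≡⇒¬cut {j} {k} {l} eq j<l l≤k c = ℕ.<⇒≱ j<l (begin
    l      ≤⟨ last-max k c l≤k ⟩
    last k ≡⟨ sym eq ⟩
    last j ≤⟨ last≤ j ⟩
    j      ∎)
    where open ℕ.≤-Reasoning

module _ {m : ℕ} (J : Subset m) where

  cut? : ∀ k → Dec (Cut J k)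
  cut? zero    = yes start
  cut? (suc k) = map′ to from
    (Fin.any? (λ i → (toℕ i ℕ.≟ k) ×-dec ¬? (i ∈? J)) ⊎-dec (k ℕ.≟ m))
    where
    to : (∃[ i ] (toℕ i ≡ k × i ∉ J)) ⊎ k ≡ m → Cut J (suc k)
    to (inj₁ (i , refl , i∉J)) = missing i i∉J
    to (inj₂ refl)             = end
    from : Cut J (suc k) → (∃[ i ] (toℕ i ≡ k × i ∉ J)) ⊎ k ≡ m
    from (missing i i∉J) = inj₁ (i , refl , i∉J)
    from end             = inj₂ refl

  open LastCut cut?

  -- A region is encoded by its lower boundary, a number monotone in the position, so that
  -- `SameRegion` becomes a decidable equality.
  region : Fin (suc m) → ℕ
  region a = last (toℕ a)

  region-mono : ∀ {a b} → a Fin.≤ b → region a ≤ region b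
  region-mono = last-mono

  -- Induction on the distance `d` to `m`; at distance zero the boundary `end` is the next cut.
  nextCut : ∀ d k → k + d ≡ m →
            ∃[ h ] (Cut J h × k < h × (∀ l → k < l → l < h → ¬ Cut J l))
  nextCut zero k e with refl ← trans (sym (ℕ.+-identityʳ k)) e =
    suc k , end , ℕ.≤-refl , λ l k<l l≤k _ → ℕ.<⇒≱ k<l (ℕ.s≤s⁻¹ l≤k)
  nextCut (suc d) k e with cut? (suc k)
  ... | yes c = suc k , c , ℕ.≤-refl , λ l k<l l≤k _ → ℕ.<⇒≱ k<l (ℕ.s≤s⁻¹ l≤k)
  ... | no ¬c with h , c , 1+k<h , none ← nextCut d (suc k) (trans (sym (ℕ.+-suc k d)) e) =
    h , c , ℕ.<⇒≤ 1+k<h , none′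
    where
    none′ : ∀ l → k < l → l < h → ¬ Cut J l
    none′ l k<l l<h with ℕ.m≤n⇒m<n∨m≡n k<l
    ... | inj₁ 1+k<l = none l 1+k<l l<h
    ... | inj₂ refl  = ¬c

  region-lo : ∀ {a} (R : Region J) → a ∈ᴿ R → region a ≡ Region.lo R
  region-lo {a} R (lo≤a , a<hi) = ℕ.≤-antisym
    (ℕ.≮⇒≥ (λ lo<last → consecutive _ lo<last
      (ℕ.≤-<-trans (last≤ (toℕ a)) a<hi) (last-cut start (toℕ a))))
    (last-max (toℕ a) lo-cut lo≤a)
    where open Region R

  SameRegion⇒region≡ : ∀ {a b} → SameRegion J a b → region a ≡ region b
  SameRegion⇒region≡ (R , a∈R , b∈R) = trans (region-lo R a∈R) (sym (region-lo R b∈R))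

  -- The region extends from the last cut up to `a` to the first cut `h` beyond `a`. If `b` reached
  -- `h`, this cut would separate the two values of `last`.
  region≡⇒SameRegion : ∀ {a b} → region a ≡ region b → SameRegion J a b
  region≡⇒SameRegion {a} {b} eq
    with d , e ← ℕ.m≤n⇒∃[o]m+o≡n (Fin.toℕ≤pred[n] a)
    with h , c , a<h , none ← nextCut d (toℕ a) e =
      R , (last≤ (toℕ a) , a<h) , (subst (_≤ toℕ b) (sym eq) (last≤ (toℕ b)) , b<h)
    where
    between : ∀ k → region a < k → k < h → ¬ Cut J k
    between k last<k k<h ck with k ℕ.≤? toℕ a
    ... | yes k≤a = ℕ.<⇒≱ last<k (last-max (toℕ a) ck k≤a)
    ... | no k≰a  = none k (ℕ.≰⇒> k≰a) k<h ck
    R : Region J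
    R = record
      { lo = region a ; hi = h ; lo-cut = last-cut start (toℕ a) ; hi-cut = c
      ; lo<hi = ℕ.≤-<-trans (last≤ (toℕ a)) a<h ; consecutive = between }
    b<h : toℕ b < h
    b<h = ℕ.≰⇒> λ h≤b → last-≡⇒¬cut {toℕ a} {toℕ b} eq a<h h≤b c

  ∈⇒region≡ : ∀ {i} → i ∈ J → region (inject₁ i) ≡ region (Fin.suc i)
  ∈⇒region≡ {i} i∈J = trans (cong last (Fin.toℕ-inject₁ i)) (sym (last-skip (toℕ i) (¬cut refl)))
    where
    ¬cut : ∀ {k} → k ≡ suc (toℕ i) → ¬ Cut J k
    ¬cut e (missing i′ i′∉J) with refl ← Fin.toℕ-injective {i = i′} {i} (ℕ.suc-injective e) = i′∉J i∈J
    ¬cut e end = ℕ.<-irrefl (sym (ℕ.suc-injective e)) (Fin.toℕ<n i)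

  region≡⇒∈ : ∀ {i} → region (inject₁ i) ≡ region (Fin.suc i) → i ∈ J
  region≡⇒∈ {i} eq = decidable-stable (i ∈? J) λ i∉J →
    last-≡⇒¬cut {toℕ (inject₁ i)} {suc (toℕ i)} eq
      (ℕ.≤-reflexive (cong suc (Fin.toℕ-inject₁ i))) ℕ.≤-refl (missing i i∉J)

-- Subsets given by decidable predicates

module _ {n : ℕ} {P : Fin n → Set} (P? : ∀ i → Dec (P i)) where

  decSubset : Subset n
  decSubset = tabulate (λ i → does (P? i))

  ∈-decSubset⁺ : ∀ {i} → P i → i ∈ decSubset
  ∈-decSubset⁺ {i} p = lookup⇒[]= i decSubset (trans (lookup∘tabulate _ i) (dec-true (P? i) p))

  ∈-decSubset⁻ : ∀ {i} → i ∈ decSubset → P i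
  ∈-decSubset⁻ {i} i∈ with P? i | trans (sym (lookup∘tabulate (λ j → does (P? j)) i)) ([]=⇒lookup i∈)
  ... | yes p | _  = p
  ... | no _  | ()

-- Set partitions

module _ {n : ℕ} (P : SetPartition n) where
  open SetPartition P using (nonempty; disjoint; covers)

  -- Disjointness is assumed for distinct parts only, but equality of subsets is decidable and may
  -- be proved by contradiction.
  part-unique : ∀ {p q a} → p List.∈ parts P → q List.∈ parts P → a ∈ p → a ∈ q → p ≡ q
  part-unique {p} {q} p∈P q∈P a∈p a∈q =
    decidable-stable (≡-dec Bool._≟_ p q) λ p≢q → disjoint p∈P q∈P p≢q (_ , x∈p∩q⁺ (a∈p , a∈q))

  SamePart-refl : ∀ a → SamePart P a a
  SamePart-refl a with p , p∈P , a∈p ← covers a = p , p∈P , a∈p , a∈p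

  SamePart-sym : ∀ {a b} → SamePart P a b → SamePart P b a
  SamePart-sym (p , p∈P , a∈p , b∈p) = p , p∈P , b∈p , a∈p

  SamePart-trans : ∀ {a b c} → SamePart P a b → SamePart P b c → SamePart P a c
  SamePart-trans (p , p∈P , a∈p , b∈p) (q , q∈P , b∈q , c∈q)
    with refl ← part-unique p∈P q∈P b∈p b∈q = p , p∈P , a∈p , c∈q

  samePart? : ∀ a b → Dec (SamePart P a b)
  samePart? a b with p , p∈P , a∈p ← covers a = map′
    (λ b∈p → p , p∈P , a∈p , b∈p)
    (λ (q , q∈P , a∈q , b∈q) → subst (b ∈_) (part-unique q∈P p∈P a∈q a∈p) b∈q)
    (b ∈? p)

  bump? : ∀ a b → Dec (Bump P a b)
  bump? a b = (a Fin.<? b) ×-dec samePart? a b ×-dec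
    Fin.all? (λ c → (a Fin.<? c) →-dec ((c Fin.<? b) →-dec ¬? (samePart? a c)))

  bump-uniqueʳ : ∀ {a b c} → Bump P a b → Bump P a c → b ≡ c
  bump-uniqueʳ {a} {b} {c} (a<b , ab , minb) (a<c , ac , minc) with Fin.<-cmp b c
  ... | tri< b<c _ _ = contradiction ab (minc b a<b b<c)
  ... | tri≈ _ b≡c _ = b≡c
  ... | tri> _ _ c<b = contradiction ac (minb c a<c c<b)

  bump-uniqueˡ : ∀ {a b c} → Bump P a c → Bump P b c → a ≡ b
  bump-uniqueˡ {a} {b} {c} (a<c , ac , mina) (b<c , bc , minb) with Fin.<-cmp a b
  ... | tri< a<b _ _ = contradiction (SamePart-trans ac (SamePart-sym bc)) (mina b a<b b<c)
  ... | tri≈ _ a≡b _ = a≡b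
  ... | tri> _ _ b<a = contradiction (SamePart-trans bc (SamePart-sym ac)) (minb a b<a a<c)

module _ {n : ℕ} (P Q : SetPartition n) where

  -- A part is a chain of bumps: a pair that is not a bump splits at an element of its part in
  -- between. The fuel `d` bounds the distance of the pair.
  bumps⊆⇒SamePart⊆ : (∀ {a b} → Bump P a b → Bump Q a b) →
                     ∀ {a b} → SamePart P a b → SamePart Q a b
  bumps⊆⇒SamePart⊆ bump⊆ {a} {b} ab = bySide (Fin.<-cmp a b)
    where
    increasing : ∀ {a b} d → toℕ b ≤ toℕ a + d → a Fin.< b → SamePart P a b → SamePart Q a b
    increasing {a} zero b≤a+d a<b _ =
      contradiction (ℕ.≤-trans b≤a+d (ℕ.≤-reflexive (ℕ.+-identityʳ (toℕ a)))) (ℕ.<⇒≱ a<b)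
    increasing {a} {b} (suc d) b≤a+d a<b ab
      with Fin.any? (λ c → (a Fin.<? c) ×-dec (c Fin.<? b) ×-dec samePart? P a c)
    ... | yes (c , a<c , c<b , ac) = SamePart-trans Q
      (increasing d (ℕ.s≤s⁻¹ (ℕ.≤-trans c<b b≤1+a+d)) a<c ac)
      (increasing d (ℕ.≤-trans b≤1+a+d (ℕ.+-monoˡ-≤ d a<c)) c<b
        (SamePart-trans P (SamePart-sym P ac) ab))
      where b≤1+a+d = ℕ.≤-trans b≤a+d (ℕ.≤-reflexive (ℕ.+-suc (toℕ a) d))
    ... | no ¬c = proj₁ (proj₂ (bump⊆ (a<b , ab , λ c a<c c<b ac → ¬c (c , a<c , c<b , ac))))
    bySide : Tri (a Fin.< b) (a ≡ b) (b Fin.< a) → SamePart Q a b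
    bySide (tri< a<b _ _)  = increasing (toℕ b) (ℕ.m≤n+m _ _) a<b ab
    bySide (tri≈ _ refl _) = SamePart-refl Q a
    bySide (tri> _ _ b<a)  =
      SamePart-sym Q (increasing (toℕ a) (ℕ.m≤n+m _ _) b<a (SamePart-sym P ab))

  SamePart⊆⇒parts⊆ : (∀ {a b} → SamePart P a b → SamePart Q a b) →
                     (∀ {a b} → SamePart Q a b → SamePart P a b) →
                     ∀ {p} → p List.∈ parts P → p List.∈ parts Q
  SamePart⊆⇒parts⊆ P⊆Q Q⊆P {p} p∈P
    with a , a∈p ← SetPartition.nonempty P p∈P
    with q , q∈Q , a∈q ← SetPartition.covers Q a =
      subst (List._∈ parts Q) (⊆-antisym q⊆p p⊆q) q∈Q
    where
    q⊆p : q ⊆ p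
    q⊆p b∈q with p′ , p′∈P , a∈p′ , b∈p′ ← Q⊆P (q , q∈Q , a∈q , b∈q)
      with refl ← part-unique P p′∈P p∈P a∈p′ a∈p = b∈p′
    p⊆q : p ⊆ q
    p⊆q b∈p with q′ , q′∈Q , a∈q′ , b∈q′ ← P⊆Q (p , p∈P , a∈p , b∈p)
      with refl ← part-unique Q q′∈Q q∈Q a∈q′ a∈q = b∈q′

  parts⊆⇒SamePart⊆ : (∀ {p} → p List.∈ parts P → p List.∈ parts Q) →
                     ∀ {a b} → SamePart P a b → SamePart Q a b
  parts⊆⇒SamePart⊆ P⊆Q (p , p∈P , ab∈p) = p , P⊆Q p∈P , ab∈p

  SamePart≡⇒bumps⊆ : (∀ {a b} → SamePart P a b → SamePart Q a b) →
                     (∀ {a b} → SamePart Q a b → SamePart P a b) →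
                     ∀ {a b} → Bump P a b → Bump Q a b
  SamePart≡⇒bumps⊆ P⊆Q Q⊆P (a<b , ab , min) =
    a<b , P⊆Q ab , λ c a<c c<b ac → min c a<c c<b (Q⊆P ac)

module _ {n : ℕ} (f : Fin n → ℕ) where

  fibre : ℕ → Subset n
  fibre v = decSubset (λ b → v ℕ.≟ f b)

  ∈-fibre⁺ : ∀ {v b} → v ≡ f b → b ∈ fibre v
  ∈-fibre⁺ {v} = ∈-decSubset⁺ (λ b → v ℕ.≟ f b)

  ∈-fibre⁻ : ∀ v {b} → b ∈ fibre v → v ≡ f b
  ∈-fibre⁻ v = ∈-decSubset⁻ (λ b → v ℕ.≟ f b)

  -- Each part is listed once per element; set equality of lists ignores the repetitions.
  fibres : SetPartition n
  fibres = record
    { parts    = map (λ a → fibre (f a)) (allFin n)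
    ; nonempty = fibre-nonempty
    ; disjoint = fibre-disjoint
    ; covers   = λ a → fibre (f a) , ∈-map⁺ _ (∈-allFin a) , ∈-fibre⁺ refl
    }
    where
    fibre-nonempty : ∀ {p} → p List.∈ map (λ a → fibre (f a)) (allFin n) → ∃[ a ] a ∈ p
    fibre-nonempty p∈ with a , _ , refl ← ∈-map⁻ _ p∈ = a , ∈-fibre⁺ refl
    fibre-disjoint : ∀ {p q} → p List.∈ map (λ a → fibre (f a)) (allFin n) →
      q List.∈ map (λ a → fibre (f a)) (allFin n) → p ≢ q → Empty (p ∩ q)
    fibre-disjoint {p} {q} p∈ q∈ p≢q (x , x∈)
      with a , _ , refl ← ∈-map⁻ _ p∈ | b , _ , refl ← ∈-map⁻ _ q∈
      with x∈a , x∈b ← x∈p∩q⁻ p q x∈ =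
        p≢q (cong fibre {f a} {f b} (trans (∈-fibre⁻ (f a) x∈a) (sym (∈-fibre⁻ (f b) x∈b))))

  SamePart-fibres⁺ : ∀ {a b} → f a ≡ f b → SamePart fibres a b
  SamePart-fibres⁺ {a} eq = fibre (f a) , ∈-map⁺ _ (∈-allFin a) , ∈-fibre⁺ refl , ∈-fibre⁺ eq

  SamePart-fibres⁻ : ∀ {a b} → SamePart fibres a b → f a ≡ f b
  SamePart-fibres⁻ (p , p∈ , a∈p , b∈p) with c , _ , refl ← ∈-map⁻ _ p∈ =
    trans (sym (∈-fibre⁻ (f c) a∈p)) (∈-fibre⁻ (f c) b∈p)

-- Permutations

-- If `y` were missed, `punchOut` would give an injection into a smaller `Fin`.
injective⇒surjective : ∀ {n} {f : Fin n → Fin n} → Injective _≡_ _≡_ f → ∀ y → ∃[ x ] f x ≡ y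
injective⇒surjective {suc n} {f} inj y with Fin.any? (λ x → f x Fin.≟ y)
... | yes hit = hit
... | no miss = contradiction
  (Fin.injective⇒≤ {f = λ x → punchOut (y≢f x)}
    (λ {x} {x′} eq → inj (Fin.punchOut-injective (y≢f x) (y≢f x′) eq)))
  ℕ.1+n≰n
  where
  y≢f : ∀ x → y ≢ f x
  y≢f x eq = miss (x , sym eq)

injective⇒permutation : ∀ {n} (f : Fin n → Fin n) → Injective _≡_ _≡_ f → Permutation′ n
injective⇒permutation f inj = Perm.permutation f
  (λ y → proj₁ (injective⇒surjective inj y))
  (λ y → proj₂ (injective⇒surjective inj y))
  (λ x → inj (proj₂ (injective⇒surjective inj (f x))))

module _ {n : ℕ} (w : Permutation′ n) where

  val : Fin n → ℕ
  val a = toℕ (w ⟨$⟩ʳ a)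

  val-injective : ∀ {a b} → val a ≡ val b → a ≡ b
  val-injective eq =
    trans (sym (Perm.inverseˡ w)) (trans (cong (w ⟨$⟩ˡ_) (Fin.toℕ-injective eq)) (Perm.inverseˡ w))

  val-surjective : ∀ {k} → k < n → ∃[ c ] val c ≡ k
  val-surjective k<n =
    w ⟨$⟩ˡ fromℕ< k<n , trans (cong toℕ (Perm.inverseʳ w)) (Fin.toℕ-fromℕ< k<n)

  val-suc : ∀ {a b} → val b < val a → ∃[ c ] val c ≡ suc (val b)
  val-suc {a} b<a = val-surjective (ℕ.≤-<-trans b<a (Fin.toℕ<n (w ⟨$⟩ʳ a)))

  Link : Fin n → Fin n → Set
  Link i k = i Fin.< k × val i ≡ suc (val k)

  Link⇒< : ∀ {i k} → Link i k → val k < val i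
  Link⇒< (_ , eq) = ℕ.≤-reflexive (sym eq)

  -- The values at which a new decreasing run of w⁻¹ begins. Zero is never one of them; its run is
  -- labelled by the default in `last`.
  Ascent : ℕ → Set
  Ascent v = ∃[ a ] ∃[ b ] (val a ≡ v × suc (val b) ≡ v × b Fin.< a)

  ascent? : ∀ v → Dec (Ascent v)
  ascent? v = Fin.any? λ a → Fin.any? λ b →
    (val a ℕ.≟ v) ×-dec (suc (val b) ℕ.≟ v) ×-dec (b Fin.<? a)

  open LastCut ascent?

  run : Fin n → ℕ
  run a = last (val a)

  Link⇒run≡ : ∀ {i k} → Link i k → run i ≡ run k
  Link⇒run≡ {i} {k} (i<k , eq) = trans (cong last eq) (last-skip (val k) ¬ascent)
    where
    ¬ascent : ¬ Ascent (suc (val k))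
    ¬ascent (a , b , va , vb , b<a)
      with refl ← val-injective (trans va (sym eq)) | refl ← val-injective (ℕ.suc-injective vb) =
        ℕ.<-asym i<k b<a

  -- Equal labels exclude an ascent at the value after w_a, so the position `c` of that value is to
  -- the left of `a`.
  run-suc : ∀ {a b} → val a < val b → run a ≡ run b → ∃[ c ] (Link c a × run c ≡ run b)
  run-suc {a} {b} a<b eq with c , vc ← val-suc a<b = c , (c<a , vc) , rc
    where
    c<a : c Fin.< a
    c<a with Fin.<-cmp c a
    ... | tri< c<a _ _ = c<a
    ... | tri≈ _ refl _ = contradiction vc (ℕ.<⇒≢ (ℕ.n<1+n _))
    ... | tri> _ _ a<c = contradiction (c , a , vc , refl , a<c)
      (last-≡⇒¬cut {val a} {val b} eq ℕ.≤-refl a<b)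
    rc : run c ≡ run b
    rc = ℕ.≤-antisym (last-mono (subst (_≤ val b) (sym vc) a<b))
      (subst (_≤ run c) eq (last-mono (ℕ.<⇒≤ (ℕ.≤-reflexive (sym vc)))))

  run-decreasing : ∀ {a b} → val a < val b → run a ≡ run b → b Fin.< a
  run-decreasing {a} {b} a<b eq with d , e ← ℕ.m≤n⇒∃[o]m+o≡n a<b = go d a<b e eq
    where
    go : ∀ {a} d → val a < val b → suc (val a) + d ≡ val b → run a ≡ run b → b Fin.< a
    go d a<b e eq with c , (c<a , vc) , rc ← run-suc a<b eq with d
    ... | zero with refl ← val-injective (trans vc (trans (sym (ℕ.+-identityʳ _)) e)) = c<a
    ... | suc d = ℕ.<-trans (go d (subst (suc (val c) ≤_) e′ (ℕ.m≤m+n _ d)) e′ rc) c<a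
      where e′ = trans (cong (λ v → suc v + d) vc) (trans (cong suc (sym (ℕ.+-suc _ d))) e)

  run-antitone : ∀ {a b} → a Fin.< b → run a ≡ run b → val b < val a
  run-antitone {a} {b} a<b eq with ℕ.<-cmp (val a) (val b)
  ... | tri< va<vb _ _ = contradiction (run-decreasing va<vb eq) (ℕ.<-asym a<b)
  ... | tri≈ _ va≡vb _ = contradiction (cong toℕ (val-injective va≡vb)) (ℕ.<⇒≢ a<b)
  ... | tri> _ _ vb<va = vb<va

  runs : SetPartition n
  runs = fibres run

  -- Values decrease along a run, so a position of the run strictly in between would have a value
  -- strictly between w_k and w_k + 1.
  Link⇒Bump : ∀ {i k} → Link i k → Bump runs i k
  Link⇒Bump {i} {k} l@(i<k , eq) = i<k , SamePart-fibres⁺ run (Link⇒run≡ l) , none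
    where
    none : ∀ c → i Fin.< c → c Fin.< k → ¬ SamePart runs i c
    none c i<c c<k ic = ℕ.<⇒≱ (run-antitone c<k (trans (sym ri≡rc) (Link⇒run≡ l)))
      (ℕ.s≤s⁻¹ (subst (val c <_) eq (run-antitone i<c ri≡rc)))
      where ri≡rc = SamePart-fibres⁻ run ic

  -- The value w_k + 1 occurs in the run at some `c < k`. The bump excludes `i < c`, and `c < i`
  -- would give w_i < w_k + 1 although w_k < w_i.
  Bump⇒Link : ∀ {i k} → Bump runs i k → Link i k
  Bump⇒Link {i} {k} (i<k , ik , none) = i<k , vi
    where
    ri≡rk = SamePart-fibres⁻ run ik
    vi : val i ≡ suc (val k)
    vi with c , (c<k , vc) , rc ← run-suc (run-antitone i<k ri≡rk) (sym ri≡rk) with Fin.<-cmp c i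
    ... | tri≈ _ refl _ = vc
    ... | tri> _ _ i<c = contradiction (SamePart-fibres⁺ run (sym rc)) (none c i<c c<k)
    ... | tri< c<i _ _ = contradiction (run-antitone c<i rc)
      (ℕ.≤⇒≯ (subst (_≤ val i) (sym vc) (run-antitone i<k ri≡rk)))

module _ {n : ℕ} (u v : Permutation′ n) where

  -- Induction on the value, each step up adding at least one. Used in both directions, this shows
  -- that a permutation is determined by the order of its values.
  same-order⇒≤ : (∀ {a b} → val u a < val u b → val v a < val v b) → ∀ a → val u a ≤ val v a
  same-order⇒≤ mono a = go (val u a) a refl
    where
    go : ∀ k a → val u a ≡ k → k ≤ val v a
    go zero    a eq = z≤n
    go (suc k) a eq
      with c , vc ← val-surjective u
        (ℕ.<-trans (ℕ.n<1+n k) (subst (_< n) eq (Fin.toℕ<n (u ⟨$⟩ʳ a)))) =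
      ℕ.≤-<-trans (go k c vc) (mono (subst (_≤ val u a) (cong suc (sym vc)) (ℕ.≤-reflexive (sym eq))))

-- Permutations from decidable linear orders

module Ranking {n : ℕ} (_≺_ : Fin n → Fin n → Set) (_≺?_ : ∀ a b → Dec (a ≺ b))
  (≺-irrefl : ∀ {a} → ¬ (a ≺ a)) (≺-trans : ∀ {a b c} → a ≺ b → b ≺ c → a ≺ c)
  (≺-total : ∀ {a b} → a ≢ b → a ≺ b ⊎ b ≺ a) where

  below : Fin n → Subset n
  below a = decSubset (_≺? a)

  ∣below∣<n : ∀ a → ∣ below a ∣ < n
  ∣below∣<n a = subst (∣ below a ∣ <_) (∣⊤∣≡n n)
    (p⊂q⇒∣p∣<∣q∣ (⊆⊤ , a , ∈⊤ , λ a∈ → ≺-irrefl (∈-decSubset⁻ (_≺? a) a∈)))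

  rank : Fin n → Fin n
  rank a = fromℕ< (∣below∣<n a)

  ≺⇒rank< : ∀ {a b} → a ≺ b → toℕ (rank a) < toℕ (rank b)
  ≺⇒rank< {a} {b} a≺b
    rewrite Fin.toℕ-fromℕ< (∣below∣<n a) | Fin.toℕ-fromℕ< (∣below∣<n b) =
    p⊂q⇒∣p∣<∣q∣
      ( (λ c∈ → ∈-decSubset⁺ (_≺? b) (≺-trans (∈-decSubset⁻ (_≺? a) c∈) a≺b))
      , a , ∈-decSubset⁺ (_≺? b) a≺b , λ a∈ → ≺-irrefl (∈-decSubset⁻ (_≺? a) a∈))

  rank-injective : Injective _≡_ _≡_ rank
  rank-injective {a} {b} eq with a Fin.≟ b
  ... | yes a≡b = a≡b
  ... | no a≢b = [ (λ a≺b → contradiction (cong toℕ eq) (ℕ.<⇒≢ (≺⇒rank< a≺b)))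
                 , (λ b≺a → contradiction (cong toℕ (sym eq)) (ℕ.<⇒≢ (≺⇒rank< b≺a))) ]′ (≺-total a≢b)

  ranking : Permutation′ n
  ranking = injective⇒permutation rank rank-injective

  rank<⇒≺ : ∀ {a b} → toℕ (rank a) < toℕ (rank b) → a ≺ b
  rank<⇒≺ {a} {b} ra<rb =
    [ (λ a≺b → a≺b) , (λ b≺a → contradiction (≺⇒rank< b≺a) (ℕ.<-asym ra<rb)) ]′
      (≺-total λ { refl → ℕ.<-irrefl refl ra<rb })

-- The inversions forced by a set of bumps

module Inversions {n : ℕ} (ρ : Fin n → ℕ) (ρ-mono : ∀ {a b} → a Fin.≤ b → ρ a ≤ ρ b)
  (B : Fin n → Fin n → Set) where

  squeezeˡ : ∀ {a b c} → a Fin.≤ b → b Fin.≤ c → ρ a ≡ ρ c → ρ a ≡ ρ b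
  squeezeˡ a≤b b≤c eq =
    ℕ.≤-antisym (ρ-mono a≤b) (ℕ.≤-trans (ρ-mono b≤c) (ℕ.≤-reflexive (sym eq)))

  squeezeʳ : ∀ {a b c} → a Fin.≤ b → b Fin.≤ c → ρ a ≡ ρ c → ρ b ≡ ρ c
  squeezeʳ a≤b b≤c eq = trans (sym (squeezeˡ a≤b b≤c eq)) eq

  -- The arc of the bump from `i` to `top` passes over `b`, which may be its right end but lies in
  -- another region than `i`. In an avoiding permutation this forces w_b < w_i.
  record Under (b i : Fin n) : Set where
    constructor under
    field
      {top} : Fin n
      bump  : B i top
      left  : i Fin.< b
      right : b Fin.≤ top
      apart : ρ i ≢ ρ b

  infix 4 _↝_

  -- In the permutation w to be reconstructed, b ↝ a forces w_b ≤ w_a.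
  data _↝_ (b a : Fin n) : Set where
    here : b Fin.≤ a → ρ b ≡ ρ a → b ↝ a
    step : ∀ {i} → Under b i → i ↝ a → b ↝ a

  under-apart : ∀ {b c i} → Under c i → i Fin.< b → b Fin.≤ c → ρ i ≢ ρ b → Under b i
  under-apart (under ik _ c≤k _) i<b b≤c i≢b = under ik i<b (ℕ.≤-trans b≤c c≤k) i≢b

  under-sameRegion : ∀ {b c i} → Under c i → b Fin.≤ c → ρ b ≡ ρ c → Under b i
  under-sameRegion {b} {c} {i} u@(under _ i<c _ i≢c) b≤c b≡c =
    under-apart u (ℕ.≰⇒> λ b≤i → i≢c (squeezeʳ b≤i (ℕ.<⇒≤ i<c) b≡c)) b≤c
      (λ i≡b → i≢c (trans i≡b b≡c))

  -- A jump after a move to the right is available already before the move: its arc starts in an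
  -- earlier region and so covers the whole stretch.
  ↝-trans : ∀ {a b c} → c ↝ b → b ↝ a → c ↝ a
  ↝-trans (step u i↝b) b↝a = step u (↝-trans i↝b b↝a)
  ↝-trans (here c≤b c≡b) (here b≤a b≡a) = here (ℕ.≤-trans c≤b b≤a) (trans c≡b b≡a)
  ↝-trans (here c≤b c≡b) (step u i↝a)   = step (under-sameRegion u c≤b c≡b) i↝a

  -- The arc of the first jump landing left of `b` also passes over `b`. Either `b` can take the
  -- same jump, or the landing point is in the region of `b` and moves right to `b`.
  ↝-split : ∀ {a b c} → a Fin.< b → b Fin.≤ c → c ↝ a → b ↝ a ⊎ c ↝ b
  ↝-split a<b b≤c (here c≤a _) = contradiction (ℕ.≤-trans b≤c c≤a) (ℕ.<⇒≱ a<b)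
  ↝-split {a} {b} a<b b≤c (step {i} u i↝a) with b Fin.≤? i
  ... | yes b≤i with ↝-split a<b b≤i i↝a
  ...   | inj₁ b↝a = inj₁ b↝a
  ...   | inj₂ i↝b = inj₂ (step u i↝b)
  ↝-split {a} {b} a<b b≤c (step {i} u i↝a) | no b≰i with ρ i ℕ.≟ ρ b
  ... | yes i≡b = inj₂ (step u (here (ℕ.<⇒≤ (ℕ.≰⇒> b≰i)) i≡b))
  ... | no i≢b  = inj₁ (step (under-apart u (ℕ.≰⇒> b≰i) b≤c i≢b) i↝a)

  -- Jumps lead to strictly earlier regions and right moves stay in a region, so a path with a jump
  -- ends in an earlier region, left of its start. The same principle gives `↝-sameRegion`.
  ↝-forward : ∀ {a b} → b ↝ a → b Fin.≤ a → ρ b ≡ ρ a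
  ↝-forward (here _ eq) _ = eq
  ↝-forward (step (under _ i<b _ i≢b) i↝a) b≤a = contradiction
    (squeezeˡ (ℕ.<⇒≤ i<b) b≤a (↝-forward i↝a (ℕ.≤-trans (ℕ.<⇒≤ i<b) b≤a))) i≢b

  ↝-sameRegion : ∀ {a b} → b ↝ a → ρ b ≡ ρ a → b Fin.≤ a
  ↝-sameRegion (here b≤a _) _ = b≤a
  ↝-sameRegion {a} (step {i} (under _ i<b _ i≢b) i↝a) b≡a with i Fin.≤? a
  ... | yes i≤a = contradiction (trans (↝-forward i↝a i≤a) (sym b≡a)) i≢b
  ... | no i≰a  =
    contradiction (squeezeʳ (ℕ.<⇒≤ (ℕ.≰⇒> i≰a)) (ℕ.<⇒≤ i<b) (sym b≡a)) i≢b

  infix 4 _≺_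

  -- The intended order of the values: `a ≺ b` is to mean w_a < w_b, with `↝` from right to left
  -- marking the inversions.
  _≺_ : Fin n → Fin n → Set
  a ≺ b = (a Fin.< b × ¬ (b ↝ a)) ⊎ (b Fin.< a × a ↝ b)

  ≺-irrefl : ∀ {a} → ¬ (a ≺ a)
  ≺-irrefl (inj₁ (a<a , _)) = ℕ.<-irrefl refl a<a
  ≺-irrefl (inj₂ (a<a , _)) = ℕ.<-irrefl refl a<a

  ≺-trans : ∀ {a b c} → a ≺ b → b ≺ c → a ≺ c
  ≺-trans (inj₁ (a<b , ¬ba)) (inj₁ (b<c , ¬cb)) =
    inj₁ (ℕ.<-trans a<b b<c , λ ca → [ ¬ba , ¬cb ]′ (↝-split a<b (ℕ.<⇒≤ b<c) ca))
  ≺-trans (inj₂ (b<a , ab)) (inj₂ (c<b , bc)) = inj₂ (ℕ.<-trans c<b b<a , ↝-trans ab bc)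
  ≺-trans {a} {b} {c} (inj₁ (a<b , ¬ba)) (inj₂ (c<b , bc)) with Fin.<-cmp a c
  ... | tri< a<c _ _  = inj₁ (a<c , λ ca → ¬ba (↝-trans bc ca))
  ... | tri≈ _ refl _ = contradiction bc ¬ba
  ... | tri> _ _ c<a  =
    inj₂ (c<a , [ (λ ac → ac) , (λ ba → contradiction ba ¬ba) ]′ (↝-split c<a (ℕ.<⇒≤ a<b) bc))
  ≺-trans {a} {b} {c} (inj₂ (b<a , ab)) (inj₁ (b<c , ¬cb)) with Fin.<-cmp a c
  ... | tri< a<c _ _  = inj₁ (a<c , λ ca → ¬cb (↝-trans ca ab))
  ... | tri≈ _ refl _ = contradiction ab ¬cb
  ... | tri> _ _ c<a  =
    inj₂ (c<a , [ (λ cb → contradiction cb ¬cb) , (λ ac → ac) ]′ (↝-split b<c (ℕ.<⇒≤ c<a) ab))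

  module Decide (B? : ∀ i k → Dec (B i k)) where

    under? : ∀ b i → Dec (Under b i)
    under? b i = map′
      (λ (k , ik , i<b , b≤k , i≢b) → under ik i<b b≤k i≢b)
      (λ (under {k} ik i<b b≤k i≢b) → k , ik , i<b , b≤k , i≢b)
      (Fin.any? λ k → B? i k ×-dec (i Fin.<? b) ×-dec (b Fin.≤? k) ×-dec ¬? (ρ i ℕ.≟ ρ b))

    _↝?_ : ∀ b a → Dec (b ↝ a)
    b ↝? a = go (<-wellFounded (toℕ b))
      where
      go : ∀ {b} → Acc _<_ (toℕ b) → Dec (b ↝ a)
      go {b} (acc rs) = map′
        (λ { (inj₁ (b≤a , b≡a)) → here b≤a b≡a ; (inj₂ (i , u , i↝a)) → step u i↝a })
        (λ { (here b≤a b≡a) → inj₁ (b≤a , b≡a) ; (step u i↝a) → inj₂ (_ , u , i↝a) })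
        (((b Fin.≤? a) ×-dec (ρ b ℕ.≟ ρ a)) ⊎-dec Fin.any? next?)
        where
        next? : ∀ i → Dec (Under b i × i ↝ a)
        next? i with under? b i
        ... | no ¬u = no (λ (u , _) → ¬u u)
        -- The jump is decided before the recursive call because it supplies the decrease in
        -- position.
        ... | yes u = map′ (u ,_) proj₂ (go (rs (Under.left u)))

    _≺?_ : ∀ a b → Dec (a ≺ b)
    a ≺? b = ((a Fin.<? b) ×-dec ¬? (b ↝? a)) ⊎-dec ((b Fin.<? a) ×-dec (a ↝? b))

    ≺-total : ∀ {a b} → a ≢ b → a ≺ b ⊎ b ≺ a
    ≺-total {a} {b} a≢b with Fin.<-cmp a b
    ... | tri≈ _ a≡b _ = contradiction a≡b a≢b
    ... | tri< a<b _ _ with b ↝? a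
    ...   | yes b↝a = inj₂ (inj₂ (a<b , b↝a))
    ...   | no ¬b↝a = inj₁ (inj₁ (a<b , ¬b↝a))
    ≺-total {a} {b} a≢b | tri> _ _ b<a with a ↝? b
    ...   | yes a↝b = inj₁ (inj₂ (b<a , a↝b))
    ...   | no ¬a↝b = inj₂ (inj₁ (b<a , ¬a↝b))

    open Ranking _≺_ _≺?_ ≺-irrefl ≺-trans ≺-total public

module _ {n : ℕ} {ρ : Fin n → ℕ} {ρ-mono : ∀ {a b} → a Fin.≤ b → ρ a ≤ ρ b}
  {B B′ : Fin n → Fin n → Set} (B⊆B′ : ∀ {i k} → B i k → B′ i k) where

  private
    module I  = Inversions ρ ρ-mono B
    module I′ = Inversions ρ ρ-mono B′

  -- Transports inversions between two permutations with the same links.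
  ↝-map : ∀ {a b} → b I.↝ a → b I′.↝ a
  ↝-map (I.here b≤a b≡a) = I′.here b≤a b≡a
  ↝-map (I.step (I.under ik i<b b≤k i≢b) i↝a) = I′.step (I′.under (B⊆B′ ik) i<b b≤k i≢b) (↝-map i↝a)

-- From avoiding permutations to noncrossing partitions

module Avoiding {m : ℕ} {J : Subset m} (A : Avoiding231 J) where
  open Avoiding231 A renaming (perm to w)
  open Inversions (region J) (region-mono J) (Link w)

  -- `inQuotient` compares neighbours; the positions in between stay in the region by monotonicity,
  -- so the comparisons chain.
  increasing : ∀ {a b} → a Fin.< b → region J a ≡ region J b → val w a < val w b
  increasing {a} {Fin.suc b} (s≤s a≤b) eq = go (<-wellFounded (toℕ b)) a≤b eq
    where
    go : ∀ {b} → Acc _<_ (toℕ b) → toℕ a ≤ toℕ b → region J a ≡ region J (Fin.suc b) →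
         val w a < val w (Fin.suc b)
    go {b} (acc rs) a≤b eq with ℕ.m≤n⇒m<n∨m≡n a≤b
    ... | inj₂ a≡b
      with refl ← Fin.toℕ-injective {i = a} {inject₁ b} (trans a≡b (sym (Fin.toℕ-inject₁ b))) =
        inQuotient b (region≡⇒∈ J eq)
    go {b@(Fin.suc b′)} (acc rs) a≤b eq | inj₁ (s≤s a≤b′) = ℕ.<-trans
      (go (rs (ℕ.≤-reflexive (cong suc (Fin.toℕ-inject₁ b′))))
        (subst (toℕ a ≤_) (sym (Fin.toℕ-inject₁ b′)) a≤b′)
        (squeezeˡ {b = inject₁ b} {Fin.suc b} a≤b₁ b₁≤b eq))
      (inQuotient b (region≡⇒∈ J (squeezeʳ {b = inject₁ b} {Fin.suc b} a≤b₁ b₁≤b eq)))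
      where
      a≤b₁ : a Fin.≤ inject₁ b
      a≤b₁ = subst (toℕ a ≤_) (sym (Fin.toℕ-inject₁ b)) a≤b
      b₁≤b : inject₁ b Fin.≤ Fin.suc b
      b₁≤b = ℕ.m≤n⇒m≤1+n (ℕ.≤-reflexive (Fin.toℕ-inject₁ b))

  -- Avoidance enters here. Suppose w_i < w_j with `j < k`. If `j` is in the region of `k`, then w_j
  -- < w_k; otherwise the three regions differ and the positions form a 231 pattern.
  link-under : ∀ {i j k} → Link w i k → i Fin.< j → j Fin.≤ k → region J i ≢ region J j →
               val w j < val w i
  link-under {i} {j} {k} (i<k , vi) i<j j≤k i≢j with ℕ.m≤n⇒m<n∨m≡n j≤k
  ... | inj₂ j≡k with refl ← Fin.toℕ-injective {i = j} {k} j≡k = ℕ.≤-reflexive (sym vi)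
  ... | inj₁ j<k with ℕ.<-cmp (val w j) (val w i) | region J j ℕ.≟ region J k
  ...   | tri< j<i _ _ | _ = j<i
  ...   | tri≈ _ j≡i _ | _ = contradiction (cong toℕ (sym (val-injective w j≡i))) (ℕ.<⇒≢ i<j)
  ...   | tri> _ _ _   | yes rj≡rk = ℕ.<-trans (increasing j<k rj≡rk) (ℕ.≤-reflexive (sym vi))
  ...   | tri> _ _ wi<wj | no rj≢rk = contradiction (record
    { i<j = i<j ; j<k = j<k
    ; ij-apart = λ ij → i≢j (SameRegion⇒region≡ J ij)
    ; jk-apart = λ jk → rj≢rk (SameRegion⇒region≡ J jk)
    ; ik-apart = λ ik → i≢j (squeezeˡ (ℕ.<⇒≤ i<j) j≤k (SameRegion⇒region≡ J ik))
    ; wk<wi = ℕ.≤-reflexive (sym vi) ; wi<wj = wi<wj ; wi≡wk+1 = vi }) (avoids i j k)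

  link-under′ : ∀ {i j k} → Link w i k → i Fin.< j → j Fin.< k → region J i ≢ region J j →
                val w j < val w k
  link-under′ {i} {j} {k} ik i<j j<k i≢j =
    ℕ.≤∧≢⇒< (ℕ.s≤s⁻¹ (subst (val w j <_) (proj₂ ik) (link-under ik i<j (ℕ.<⇒≤ j<k) i≢j)))
      (λ eq → ℕ.<⇒≢ j<k (cong toℕ (val-injective w eq)))

  -- Together with `val<⇒↝`, this identifies the inversions of `w` with the pairs `b ↝ a` for
  -- `a < b`.
  ↝⇒val≤ : ∀ {a b} → b ↝ a → val w b ≤ val w a
  ↝⇒val≤ {a} {b} (here b≤a b≡a) with ℕ.m≤n⇒m<n∨m≡n b≤a
  ... | inj₁ b<a = ℕ.<⇒≤ (increasing b<a b≡a)
  ... | inj₂ eq with refl ← Fin.toℕ-injective {i = b} {a} eq = ℕ.≤-refl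
  ↝⇒val≤ (step (under ik i<b b≤k i≢b) i↝a) =
    ℕ.≤-trans (ℕ.<⇒≤ (link-under ik i<b b≤k i≢b)) (↝⇒val≤ i↝a)

  -- Going up from the value w_b to w_a, some consecutive values pass from position ≥ b to one < b.
  crossing-link : ∀ {a b} → a Fin.< b → val w b < val w a →
    ∃[ i ] ∃[ k ] (Link w i k × i Fin.< b × b Fin.≤ k × val w b ≤ val w k × val w i ≤ val w a)
  crossing-link {a} {b} a<b wb<wa with d , e ← ℕ.m≤n⇒∃[o]m+o≡n wb<wa = go d b e ℕ.≤-refl ℕ.≤-refl
    where
    go : ∀ d c → suc (val w c) + d ≡ val w a → val w b ≤ val w c → b Fin.≤ c →
      ∃[ i ] ∃[ k ] (Link w i k × i Fin.< b × b Fin.≤ k × val w b ≤ val w k × val w i ≤ val w a)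
    go d c e wb≤wc b≤c with wc<wa ← subst (val w c <_) e (ℕ.m≤m+n _ d)
      with x , vx ← val-suc w wc<wa with x Fin.<? b
    ... | yes x<b =
      x , c , (ℕ.<-≤-trans x<b b≤c , vx) , x<b , b≤c , wb≤wc , subst (_≤ val w a) (sym vx) wc<wa
    go zero c e wb≤wc b≤c | no x≮b
      with refl ← val-injective w (trans vx (trans (sym (ℕ.+-identityʳ _)) e)) = contradiction a<b x≮b
    go (suc d) c e wb≤wc b≤c | no x≮b = go d x
      (trans (cong (λ v → suc v + d) vx) (trans (cong suc (sym (ℕ.+-suc _ d))) e))
      (ℕ.≤-trans wb≤wc (ℕ.<⇒≤ (ℕ.≤-reflexive (sym vx)))) (ℕ.≮⇒≥ x≮b)

  -- A link crossing `b` gives the first jump, to some `i` with w_i ≤ w_a. If `i < a` in different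
  -- regions, the arc also passes over `a` and forces w_a < w_i, which is absurd; otherwise `i` is
  -- `a`, moves right to it, or recursion applies.
  val<⇒↝ : ∀ {a b} → a Fin.< b → val w b < val w a → b ↝ a
  val<⇒↝ {b = b} = go (<-wellFounded (toℕ b))
    where
    go : ∀ {a b} → Acc _<_ (toℕ b) → a Fin.< b → val w b < val w a → b ↝ a
    go {a} {b} (acc rs) a<b wb<wa
      with i , k , ik , i<b , b≤k , wb≤wk , wi≤wa ← crossing-link a<b wb<wa =
        step (under ik i<b b≤k i≢b) i↝a
      where
      i≢b : region J i ≢ region J b
      i≢b eq = ℕ.<-asym (increasing i<b eq) (ℕ.≤-<-trans wb≤wk (Link⇒< w ik))
      i↝a : i ↝ a
      i↝a with Fin.<-cmp a i
      ... | tri≈ _ refl _ = here ℕ.≤-refl refl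
      ... | tri< a<i _ _ =
        go (rs i<b) a<i (ℕ.≤∧≢⇒< wi≤wa λ eq → ℕ.<⇒≢ a<i (cong toℕ (sym (val-injective w eq))))
      ... | tri> _ _ i<a with region J i ℕ.≟ region J a
      ...   | yes i≡a = here (ℕ.<⇒≤ i<a) i≡a
      ...   | no i≢a = contradiction (link-under ik i<a (ℕ.≤-trans (ℕ.<⇒≤ a<b) b≤k) i≢a) (ℕ.≤⇒≯ wi≤wa)

  noncrossing : NoncrossingPartition J
  noncrossing = record
    { partition = runs w
    ; isNoncrossing = record
      { nc1 = nc1
      ; nc2 = λ b₁ b₂ → nc2 (Bump⇒Link w b₁) (Bump⇒Link w b₂)
      ; nc3 = λ b₁ b₂ → nc3 (Bump⇒Link w b₁) (Bump⇒Link w b₂) } }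
    where
    nc1 : ∀ {a b} → a ≢ b → SameRegion J a b → ¬ SamePart (runs w) a b
    nc1 {a} {b} a≢b same ab with eq ← SameRegion⇒region≡ J same | r ← SamePart-fibres⁻ (run w) ab
      with Fin.<-cmp a b
    ... | tri< a<b _ _ = ℕ.<-asym (increasing a<b eq) (run-antitone w a<b r)
    ... | tri≈ _ a≡b _ = a≢b a≡b
    ... | tri> _ _ b<a = ℕ.<-asym (increasing b<a (sym eq)) (run-antitone w b<a (sym r))
    nc2 : ∀ {i₁ i₂ j₁ j₂} → Link w i₁ i₂ → Link w j₁ j₂ →
          i₁ Fin.< j₁ → j₁ Fin.< i₂ → i₂ Fin.< j₂ → SameRegion J i₁ j₁ ⊎ SameRegion J i₂ j₁
    nc2 {i₁} {i₂} {j₁} {j₂} l₁ l₂ i₁<j₁ j₁<i₂ i₂<j₂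
      with region J i₁ ℕ.≟ region J j₁ | region J i₂ ℕ.≟ region J j₁
    ... | yes eq | _      = inj₁ (region≡⇒SameRegion J eq)
    ... | no _   | yes eq = inj₂ (region≡⇒SameRegion J eq)
    -- Each arc passes over an end of the other: the first gives w_j₁ < w_i₂, the second w_i₂ < w_j₂
    -- < w_j₁.
    ... | no i₁≢j₁ | no i₂≢j₁ = contradiction
      (ℕ.<-trans (link-under′ l₂ j₁<i₂ i₂<j₂ (i₂≢j₁ ∘ sym)) (Link⇒< w l₂))
      (ℕ.<-asym (link-under′ l₁ i₁<j₁ j₁<i₂ i₁≢j₁))
    nc3 : ∀ {i₁ i₂ j₁ j₂} → Link w i₁ i₂ → Link w j₁ j₂ →
          i₁ Fin.< j₁ → j₁ Fin.< j₂ → j₂ Fin.< i₂ → ¬ SameRegion J i₁ j₁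
    -- The outer arc passes over `j₂`, which pushes w_j₁ = w_j₂ + 1 below w_i₁, against the increase
    -- inside the common region.
    nc3 {i₁} {i₂} {j₁} {j₂} l₁ l₂ i₁<j₁ j₁<j₂ j₂<i₂ same =
      ℕ.<⇒≱ (increasing i₁<j₁ eq) (begin
        val w j₁       ≡⟨ proj₂ l₂ ⟩
        suc (val w j₂) ≤⟨ link-under′ l₁ (ℕ.<-trans i₁<j₁ j₁<j₂) j₂<i₂ i₁≢j₂ ⟩
        val w i₂       ≤⟨ ℕ.<⇒≤ (Link⇒< w l₁) ⟩
        val w i₁       ∎)
      where
      open ℕ.≤-Reasoning
      eq = SameRegion⇒region≡ J same
      i₁≢j₂ : region J i₁ ≢ region J j₂
      i₁≢j₂ eq′ = ℕ.<-asym (increasing j₁<j₂ (trans (sym eq) eq′)) (Link⇒< w l₂)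

-- From noncrossing partitions to avoiding permutations

module Noncrossing {m : ℕ} {J : Subset m} (N : NoncrossingPartition J) where
  open NoncrossingPartition N renaming (partition to P)
  open IsNoncrossing isNoncrossing
  open Inversions (region J) (region-mono J) (Bump P)

  bump-apart : ∀ {i k} → Bump P i k → region J i ≢ region J k
  bump-apart (i<k , ik , _) eq =
    nc1 (λ i≡k → ℕ.<⇒≢ i<k (cong toℕ i≡k)) (region≡⇒SameRegion J eq) ik

  bump⇒under : ∀ {i k} → Bump P i k → Under k i
  bump⇒under b = under b (proj₁ b) ℕ.≤-refl (bump-apart b)

  nc2-region : ∀ {i₁ i₂ j₁ j₂} → Bump P i₁ i₂ → Bump P j₁ j₂ →
    i₁ Fin.< j₁ → j₁ Fin.< i₂ → i₂ Fin.< j₂ → region J j₁ ≢ region J i₂ → region J i₁ ≡ region J j₁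
  nc2-region b₁ b₂ p q r j₁≢i₂ with nc2 b₁ b₂ p q r
  ... | inj₁ same = SameRegion⇒region≡ J same
  ... | inj₂ same = contradiction (sym (SameRegion⇒region≡ J same)) j₁≢i₂

  -- Consider the first jump from `k`, to `i₁`. Its arc is the bump itself or ends beyond `k`. If
  -- `i₁ < i`, nc3 lets `i` take the same jump; if `i < i₁`, nc2 lets `i` move right to `i₁`.
  bump-↝-left : ∀ {i j k} → Bump P i k → j Fin.< i → k ↝ j → i ↝ j
  bump-↝-left (i<k , _) j<i (here k≤j _) = contradiction k≤j (ℕ.<⇒≱ (ℕ.<-trans j<i i<k))
  bump-↝-left {i} {j} {k} b@(i<k , _) j<i (step {i₁} (under {k₁} b₁ i₁<k k≤k₁ i₁≢k) i₁↝j)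
    with ℕ.m≤n⇒m<n∨m≡n k≤k₁
  ... | inj₂ k≡k₁ with refl ← Fin.toℕ-injective {i = k} {k₁} k≡k₁
    with refl ← bump-uniqueˡ P b b₁ = i₁↝j
  ... | inj₁ k<k₁ with Fin.<-cmp i₁ i
  ...   | tri≈ _ refl _ = i₁↝j
  ...   | tri< i₁<i _ _ = step
    (under b₁ i₁<i (ℕ.<⇒≤ (ℕ.<-trans i<k k<k₁)) λ eq → nc3 b₁ b i₁<i i<k k<k₁ (region≡⇒SameRegion J eq))
    i₁↝j
  ...   | tri> _ _ i<i₁ =
    ↝-trans (here (ℕ.<⇒≤ i<i₁) (nc2-region b b₁ i<i₁ i₁<k k<k₁ i₁≢k)) i₁↝j

  -- Follow the path until it lands at or left of `k`. If the landing point `i₁` is neither `k` nor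
  -- in its region, then nesting contradicts nc3, and crossing puts `i₁` in the region of `i` but to
  -- its right, from where `i` is out of reach.
  bump-↝-right : ∀ {c i k} → Bump P i k → k Fin.< c → c ↝ i → c ↝ k
  bump-↝-right (i<k , _) k<c (here c≤i _) = contradiction c≤i (ℕ.<⇒≱ (ℕ.<-trans i<k k<c))
  bump-↝-right {c} {i} {k} b@(i<k , _) k<c (step {i₁} u@(under b₁ i₁<c c≤k₁ _) i₁↝i)
    with Fin.<-cmp i₁ k
  ... | tri> _ _ k<i₁ = step u (bump-↝-right b k<i₁ i₁↝i)
  ... | tri≈ _ refl _ = step u (here ℕ.≤-refl refl)
  ... | tri< i₁<k _ _ with region J i₁ ℕ.≟ region J k
  ...   | yes i₁≡k = step u (here (ℕ.<⇒≤ i₁<k) i₁≡k)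
  ...   | no i₁≢k with k<k₁ ← ℕ.<-≤-trans k<c c≤k₁ with Fin.<-cmp i₁ i
  ...     | tri≈ _ refl _ = contradiction (cong toℕ (bump-uniqueʳ P b b₁)) (ℕ.<⇒≢ k<k₁)
  ...     | tri< i₁<i _ _ = contradiction
    (region≡⇒SameRegion J (↝-forward i₁↝i (ℕ.<⇒≤ i₁<i))) (nc3 b₁ b i₁<i i<k k<k₁)
  ...     | tri> _ _ i<i₁ = contradiction
    (↝-sameRegion i₁↝i (sym (nc2-region b b₁ i<i₁ i₁<k k<k₁ i₁≢k))) (ℕ.<⇒≱ i<i₁)

  -- Again by the first jump from `k`. Landing at `i₁ < i` would put `i₁` and `i` in one region,
  -- against nc3; landing at `i₁ > i` puts them in one region by nc2, and `j` is squeezed between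
  -- them or reached forward.
  bump-↝-inner : ∀ {i j k} → Bump P i k → i Fin.< j → j Fin.< k → k ↝ j → region J i ≡ region J j
  bump-↝-inner _ i<j j<k (here k≤j _) = contradiction k≤j (ℕ.<⇒≱ j<k)
  bump-↝-inner {i} {j} {k} b@(i<k , _) i<j j<k (step {i₁} (under {k₁} b₁ i₁<k k≤k₁ i₁≢k) i₁↝j)
    with ℕ.m≤n⇒m<n∨m≡n k≤k₁
  ... | inj₂ k≡k₁ with refl ← Fin.toℕ-injective {i = k} {k₁} k≡k₁
    with refl ← bump-uniqueˡ P b b₁ = ↝-forward i₁↝j (ℕ.<⇒≤ i<j)
  ... | inj₁ k<k₁ with Fin.<-cmp i₁ i
  ...   | tri≈ _ refl _ = contradiction (cong toℕ (bump-uniqueʳ P b b₁)) (ℕ.<⇒≢ k<k₁)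
  ...   | tri< i₁<i _ _ = contradiction
    (region≡⇒SameRegion J (squeezeˡ (ℕ.<⇒≤ i₁<i) (ℕ.<⇒≤ i<j)
      (↝-forward i₁↝j (ℕ.<⇒≤ (ℕ.<-trans i₁<i i<j)))))
    (nc3 b₁ b i₁<i i<k k<k₁)
  ...   | tri> _ _ i<i₁ with i≡i₁ ← nc2-region b b₁ i<i₁ i₁<k k<k₁ i₁≢k with i₁ Fin.≤? j
  ...     | yes i₁≤j = trans i≡i₁ (↝-forward i₁↝j i₁≤j)
  ...     | no i₁≰j  = squeezeˡ (ℕ.<⇒≤ i<j) (ℕ.<⇒≤ (ℕ.≰⇒> i₁≰j)) i≡i₁

  -- The three preceding lemmas exclude `j` to the right of `k`, to the left of `i` and in between.
  bump-adjacent : ∀ {i j k} → Bump P i k → k ≺ j → ¬ (j ≺ i)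
  bump-adjacent b (inj₁ (k<j , ¬jk)) (inj₂ (_ , ji)) = ¬jk (bump-↝-right b k<j ji)
  bump-adjacent b (inj₁ (k<j , _)) (inj₁ (j<i , _)) = ℕ.<-asym (proj₁ b) (ℕ.<-trans k<j j<i)
  bump-adjacent b (inj₂ (_ , kj)) (inj₁ (j<i , ¬ij)) = ¬ij (bump-↝-left b j<i kj)
  bump-adjacent {i} {j} {k} b (inj₂ (j<k , kj)) (inj₂ (i<j , ji)) =
    ℕ.<⇒≱ i<j (↝-sameRegion ji (sym (bump-↝-inner b i<j j<k kj)))

  bump⇒≺ : ∀ {i k} → Bump P i k → k ≺ i
  bump⇒≺ b = inj₂ (proj₁ b , step (bump⇒under b) (here ℕ.≤-refl refl))

  module Ordered (w : Permutation′ (suc m)) (≺⇒val< : ∀ {a b} → a ≺ b → val w a < val w b)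
    (val<⇒≺ : ∀ {a b} → val w a < val w b → a ≺ b) where

    Bump⇒Linkʷ : ∀ {i k} → Bump P i k → Link w i k
    Bump⇒Linkʷ {i} {k} b with k<i ← ≺⇒val< (bump⇒≺ b) with c , vc ← val-suc w k<i
      with ℕ.m≤n⇒m<n∨m≡n (subst (_≤ val w i) (sym vc) k<i)
    ... | inj₂ c≡i = proj₁ b , trans (sym c≡i) vc
    ... | inj₁ c<i = contradiction (val<⇒≺ c<i)
      (bump-adjacent b (val<⇒≺ (ℕ.≤-reflexive (sym vc))))

    ↝⇒val≤ : ∀ {a b} → b ↝ a → val w b ≤ val w a
    ↝⇒val≤ {a} {b} ba with Fin.<-cmp a b
    ... | tri< a<b _ _  = ℕ.<⇒≤ (≺⇒val< (inj₂ (a<b , ba)))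
    ... | tri≈ _ refl _ = ℕ.≤-refl
    ... | tri> _ _ b<a  = ℕ.<⇒≤ (≺⇒val< (inj₁ (b<a , λ ab →
      ℕ.<⇒≱ b<a (↝-sameRegion ab (sym (↝-forward ba (ℕ.<⇒≤ b<a)))))))

    -- The inversion is a path from `k` to `i` starting with a jump along some bump from `i₁` to
    -- `k₁`. Since w_k < w_i₁ ≤ w_i = w_k + 1, the left ends agree, and then so do the right ends
    -- because that bump is a link.
    Linkʷ⇒Bump : ∀ {i k} → Link w i k → Bump P i k
    Linkʷ⇒Bump {i} {k} l@(i<k , vi) with val<⇒≺ {k} {i} (Link⇒< w l)
    ... | inj₁ (k<i , _) = contradiction i<k (ℕ.<-asym k<i)
    ... | inj₂ (_ , here k≤i _) = contradiction k≤i (ℕ.<⇒≱ i<k)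
    ... | inj₂ (_ , step {i₁} u@(under {k₁} b₁ i₁<k k≤k₁ i₁≢k) i₁↝i)
      with refl ← val-injective w (ℕ.≤-antisym (↝⇒val≤ i₁↝i)
        (subst (_≤ val w i₁) (sym vi) (≺⇒val< (inj₂ (i₁<k , step u (here ℕ.≤-refl refl))))))
      with refl ← val-injective w (ℕ.suc-injective (trans (sym vi) (proj₂ (Bump⇒Linkʷ b₁)))) = b₁

    avoiding : Avoiding231 J
    avoiding = record
      { perm       = w
      ; inQuotient = λ i i∈J → ≺⇒val< {inject₁ i} {Fin.suc i} (inj₁
          ( i₁<i i , λ r → ℕ.<⇒≱ (i₁<i i) (↝-sameRegion r (sym (∈⇒region≡ J i∈J)))))
      ; avoids     = avoids
      }
      where
      i₁<i : ∀ (i : Fin m) → inject₁ i Fin.< Fin.suc i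
      i₁<i i = ℕ.≤-reflexive (cong suc (Fin.toℕ-inject₁ i))
      avoids : ∀ i j k → ¬ Is231Pattern J w i j k
      -- The outer positions form a link, hence a bump, whose arc passes over `j` and forces w_j <
      -- w_i.
      avoids i j k p = ℕ.<-asym wi<wj (≺⇒val< (inj₂ (i<j , step
        (under (Linkʷ⇒Bump (ℕ.<-trans i<j j<k , wi≡wk+1)) i<j (ℕ.<⇒≤ j<k)
          (λ eq → ij-apart (region≡⇒SameRegion J eq)))
        (here ℕ.≤-refl refl))))
        where open Is231Pattern p

  realisation : ∃[ A ] ((∀ {i k} → Link (Avoiding231.perm {J = J} A) i k → Bump P i k) ×
                        (∀ {i k} → Bump P i k → Link (Avoiding231.perm A) i k))
  realisation = avoiding , Linkʷ⇒Bump , Bump⇒Linkʷ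
    where
    open Decide (bump? P)
    open Ordered ranking ≺⇒rank< rank<⇒≺

-- The bijection

module _ {m : ℕ} {J : Subset m} (A A′ : Avoiding231 J) where
  open Avoiding231 A  renaming (perm to w)
  open Avoiding231 A′ renaming (perm to w′)

  -- Links generate all inversions through `↝`. An inversion of `w` is carried over to `w′`, and an
  -- inversion of `w′` at a non-inversion of `w` would be carried back.
  links⇒same-order : (∀ {i k} → Link w i k → Link w′ i k) → (∀ {i k} → Link w′ i k → Link w i k) →
                     ∀ {a b} → val w a < val w b → val w′ a < val w′ b
  links⇒same-order l⁺ l⁻ {a} {b} a<b with Fin.<-cmp a b
  ... | tri≈ _ refl _ = contradiction a<b (ℕ.<-irrefl refl)
  ... | tri> _ _ q = ℕ.≤∧≢⇒<
    (Avoiding.↝⇒val≤ A′ (↝-map l⁺ (Avoiding.val<⇒↝ A q a<b)))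
    (λ eq → ℕ.<⇒≢ q (cong toℕ (sym (val-injective w′ eq))))
  ... | tri< q _ _ with ℕ.<-cmp (val w′ a) (val w′ b)
  ...   | tri< p _ _ = p
  ...   | tri≈ _ eq _ = contradiction (cong toℕ (val-injective w′ eq)) (ℕ.<⇒≢ q)
  ...   | tri> _ _ p = contradiction (Avoiding.↝⇒val≤ A (↝-map l⁻ (Avoiding.val<⇒↝ A′ q p))) (ℕ.<⇒≱ a<b)

-- Bumps determine a partition, so it suffices to match them with links.
runs-cong : ∀ {n} (w : Permutation′ n) (P : SetPartition n) →
  (∀ {i k} → Link w i k → Bump P i k) → (∀ {i k} → Bump P i k → Link w i k) →
  ∀ {p} → (p List.∈ parts (runs w)) ⇔ (p List.∈ parts P)
runs-cong w P l⁺ l⁻ =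
  mk⇔ (SamePart⊆⇒parts⊆ (runs w) P ⊆₁ ⊆₂) (SamePart⊆⇒parts⊆ P (runs w) ⊆₂ ⊆₁)
  where
  ⊆₁ : ∀ {a b} → SamePart (runs w) a b → SamePart P a b
  ⊆₁ = bumps⊆⇒SamePart⊆ (runs w) P (l⁺ ∘ Bump⇒Link w)
  ⊆₂ : ∀ {a b} → SamePart P a b → SamePart (runs w) a b
  ⊆₂ = bumps⊆⇒SamePart⊆ P (runs w) (Link⇒Bump w ∘ l⁻)

Link-resp-≈ : ∀ {n} {u v : Permutation′ n} → u Perm.≈ v → ∀ {i k} → Link u i k → Link v i k
Link-resp-≈ u≈v {i} {k} (i<k , eq) =
  i<k , trans (cong toℕ (sym (u≈v i))) (trans eq (cong (suc ∘ toℕ) (u≈v k)))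

theorem4p2 : (m : ℕ) (J : Subset m) → Bijection (𝔖231 J) (NC J)
theorem4p2 m J = record
  { to        = Avoiding.noncrossing
  ; cong      = λ {A} {A′} → to-cong A A′
  ; bijective = (λ {A} {A′} → to-injective A A′) , to-surjective
  }
  where
  open Setoid using (_≈_)
  to-cong : ∀ A A′ → _≈_ (𝔖231 J) A A′ → _≈_ (NC J) (Avoiding.noncrossing A) (Avoiding.noncrossing A′)
  to-cong A A′ eq = runs-cong w (runs w′)
    (Link⇒Bump w′ ∘ Link-resp-≈ {u = w} {w′} eq)
    (Link-resp-≈ {u = w′} {w} (sym ∘ eq) ∘ Bump⇒Link w′)
    where
    open Avoiding231 A  using () renaming (perm to w)
    open Avoiding231 A′ using () renaming (perm to w′)
  to-injective : ∀ A A′ → _≈_ (NC J) (Avoiding.noncrossing A) (Avoiding.noncrossing A′) →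
                 _≈_ (𝔖231 J) A A′
  -- Equal partitions have equal bumps, hence the permutations have equal links and the same order
  -- of values.
  to-injective A A′ eq a = Fin.toℕ-injective (ℕ.≤-antisym
    (same-order⇒≤ w w′ (links⇒same-order A A′ l⁺ l⁻) a)
    (same-order⇒≤ w′ w (links⇒same-order A′ A l⁻ l⁺) a))
    where
    open Avoiding231 A  using () renaming (perm to w)
    open Avoiding231 A′ using () renaming (perm to w′)
    s⁺ : ∀ {a b} → SamePart (runs w) a b → SamePart (runs w′) a b
    s⁺ = parts⊆⇒SamePart⊆ (runs w) (runs w′) (Equivalence.to eq)
    s⁻ : ∀ {a b} → SamePart (runs w′) a b → SamePart (runs w) a b
    s⁻ = parts⊆⇒SamePart⊆ (runs w′) (runs w) (Equivalence.from eq)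
    l⁺ : ∀ {i k} → Link w i k → Link w′ i k
    l⁺ = Bump⇒Link w′ ∘ SamePart≡⇒bumps⊆ (runs w) (runs w′) s⁺ s⁻ ∘ Link⇒Bump w
    l⁻ : ∀ {i k} → Link w′ i k → Link w i k
    l⁻ = Bump⇒Link w ∘ SamePart≡⇒bumps⊆ (runs w′) (runs w) s⁻ s⁺ ∘ Link⇒Bump w′
  to-surjective : ∀ N → ∃[ A ] (∀ {A′} → _≈_ (𝔖231 J) A′ A → _≈_ (NC J) (Avoiding.noncrossing A′) N)
  to-surjective N = preimage (Noncrossing.realisation N)
    where
    P = NoncrossingPartition.partition N
    preimage : ∃[ A ] ((∀ {i k} → Link (Avoiding231.perm {J = J} A) i k → Bump P i k) ×
                       (∀ {i k} → Bump P i k → Link (Avoiding231.perm A) i k)) →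
               ∃[ A ] (∀ {A′} → _≈_ (𝔖231 J) A′ A → _≈_ (NC J) (Avoiding.noncrossing A′) N)
    preimage (A , l⁺ , l⁻) = A , λ {A′} eq → runs-cong (Avoiding231.perm A′) P
      (l⁺ ∘ Link-resp-≈ {u = Avoiding231.perm A′} {Avoiding231.perm A} eq)
      (Link-resp-≈ {u = Avoiding231.perm A} {Avoiding231.perm A′} (sym ∘ eq) ∘ l⁻)
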